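{- If $G$ is a complete $k$-partite graph with $k\ge 3$, then $G$ is antimagic.
   Context: All graphs are finite, undirected and simple. A complete $k$-partite graph is a graph whose vertex set can be partitioned into $k$ nonempty classes such that two vertices are adjacent if and only if they belong to different classes. An antimagic labeling of a graph with $m$ edges and $n$ vertices is a bijection from the set of edges to the integers $\{1,\ldots,m\}$ such that all $n$ vertex sums are pairwise distinct, where a vertex sum is the sum of the labels of all edges incident with that vertex. A graph is called antimagic if it has an antimagic labeling. -}

module Defs where

open import Data.Fin using (Fin; toℕ; _<_)
open import Data.Fin.Properties using (_≟_; _<?_)
open import Data.List using (List; []; _∷_; allFin; cartesianProduct; filter; length; map; mapMaybe; sum)
open import Data.List.Membership.Propositional using (_∈_)
open import Data.List.Membership.Propositional.Properties using (∈-allFin; ∈-cartesianProduct⁺)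
open import Data.List.Relation.Unary.All using (All; []; _∷_)
open import Data.List.Relation.Unary.AllPairs using ([]; _∷_)
open import Data.List.Relation.Unary.Any using (here; there)
open import Data.List.Relation.Unary.Unique.Propositional using (Unique)
open import Data.List.Relation.Unary.Unique.Propositional.Properties using (allFin⁺; cartesianProduct⁺)
open import Data.Maybe using (Maybe; just; nothing)
open import Data.Nat using (ℕ; suc)
open import Data.Product using (_×_; _,_; ∃-syntax)
open import Data.Sum using (_⊎_)
open import Function.Bundles using (_⇔_; _⤖_; module Bijection)
open import Function.Definitions using (Injective; Surjective)
open import Level using (0ℓ)
open import Relation.Binary.Core using (Rel)
open import Relation.Binary.Definitions using (Decidable; Irreflexive; Symmetric)
open import Relation.Binary.PropositionalEquality using (_≡_; _≢_; refl; sym; trans)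
open import Relation.Nullary using (Dec; yes; no; contradiction-irr)
open import Relation.Nullary.Decidable using (_⊎-dec_)

record Graph : Set₁ where
  field
    n        : ℕ
    _~_      : Rel (Fin n) 0ℓ
    _~?_     : Decidable _~_
    ~-sym    : Symmetric _~_
    ~-irrefl : Irreflexive _≡_ _~_

  Vertex : Set
  Vertex = Fin n

  -- The unordered pair {u , v} is represented by its increasing ordering; the
  -- proof fields are irrelevant, so edges are equal as soon as their endpoints
  -- are.
  record Edge : Set where
    eta-equality
    constructor edge
    field
      src tgt   : Vertex
      .ordered  : src < tgt
      .adjacent : src ~ tgt

  open Edge public

  edge? : Vertex × Vertex → Maybe Edge
  edge? (u , v) with u <? v | u ~? v
  ... | yes u<v | yes u~v = just (edge u v u<v u~v)
  ... | yes _   | no _    = nothing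
  ... | no _    | _       = nothing

  -- Lists every edge exactly once: see ∈-edges and edges-unique.
  edges : List Edge
  edges = mapMaybe edge? (cartesianProduct (allFin n) (allFin n))

  edge?-complete : ∀ e → edge? (src e , tgt e) ≡ just e
  edge?-complete (edge u v u<v u~v) with u <? v | u ~? v
  ... | yes _   | yes _   = refl
  ... | yes _   | no ¬u~v = contradiction-irr u~v ¬u~v
  ... | no ¬u<v | _       = contradiction-irr u<v ¬u<v

  edge?-sound : ∀ p {e} → edge? p ≡ just e → p ≡ (src e , tgt e)
  edge?-sound (u , v) eq with u <? v | u ~? v
  edge?-sound (u , v) refl | yes _ | yes _ = refl

  ∈-edges : ∀ e → e ∈ edges
  ∈-edges e = go (∈-cartesianProduct⁺ (∈-allFin (src e)) (∈-allFin (tgt e)))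
    where
    go : ∀ {ps} → (src e , tgt e) ∈ ps → e ∈ mapMaybe edge? ps
    go (here refl) rewrite edge?-complete e = here refl
    go {p ∷ _} (there i) with edge? p
    ... | just _  = there (go i)
    ... | nothing = go i

  edges-unique : Unique edges
  edges-unique = go (cartesianProduct⁺ (allFin⁺ n) (allFin⁺ n))
    where
    fresh : ∀ {p e ps} → edge? p ≡ just e → All (p ≢_) ps → All (e ≢_) (mapMaybe edge? ps)
    fresh {ps = []} _ [] = []
    fresh {p} {e} {q ∷ _} eq (p≢q ∷ rest) with edge? q in eq′
    ... | nothing = fresh eq rest
    ... | just _  = (λ { refl → p≢q (trans (edge?-sound p eq) (sym (edge?-sound q eq′))) }) ∷ fresh eq rest

    go : ∀ {ps} → Unique ps → Unique (mapMaybe edge? ps)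
    go [] = []
    go {p ∷ _} (p∉ps ∷ u) with edge? p in eq
    ... | nothing = go u
    ... | just _  = fresh eq p∉ps ∷ go u

  m : ℕ
  m = length edges

  Incident : Vertex → Edge → Set
  Incident v e = v ≡ src e ⊎ v ≡ tgt e

  incident? : ∀ v e → Dec (Incident v e)
  incident? v e = (v ≟ src e) ⊎-dec (v ≟ tgt e)

  Labeling : Set
  Labeling = Edge ⤖ Fin m

  -- Fin m is {0,…,m-1}; the shift by one gives labels {1,…,m}.
  label : Labeling → Edge → ℕ
  label φ e = suc (toℕ (Bijection.to φ e))

  vertexSum : Labeling → Vertex → ℕ
  vertexSum φ v = sum (map (label φ) (filter (incident? v) edges))

  IsAntimagic : Labeling → Set
  IsAntimagic φ = Injective _≡_ _≡_ (vertexSum φ)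

Antimagic : Graph → Set
Antimagic G = ∃[ φ ] IsAntimagic φ
  where open Graph G

-- The classes are the fibres of c; surjectivity says that they are nonempty.
CompleteMultipartite : ℕ → Graph → Set
CompleteMultipartite k G =
  ∃[ c ] Surjective {A = Vertex} {B = Fin k} _≡_ _≡_ c × (∀ u v → (u ~ v) ⇔ (c u ≢ c v))
  where open Graph G

{-# OPTIONS --safe #-}
module Submission where

-- Let A be a smallest class, of size p, and B the set of the q ≥ 2p remaining
-- vertices (this is where k ≥ 3 enters).  Give the μ edges inside B the labels
-- 1, …, μ arbitrarily, and list B as b₀, …, b_{q-1} by increasing partial sums.
-- The row of edges from b_j to A gets the labels μ + pj + 1, …, μ + pj + p, so
-- the sums at B strictly increase with j.  Each row runs through A in a fixed
-- order a₀, …, a_{p-1}, except that the first p - 1 rows run backwards, so a_i has sum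
-- q(μ + 1) + p q(q - 1)/2 + (p - 1)² + (q - 2p + 2) i; these are distinct.  A vertex
-- of B has at most q - p neighbours in B, so its sum is at most
-- (q - p) μ + p (μ + pq), which is less than every sum at A.

open import Defs
open import Data.Nat using (ℕ; _≤_)

open import Data.Bool using (Bool; true; false; if_then_else_)
open import Data.Fin as Fin using (Fin; zero; suc; toℕ; opposite; punchIn; combine)
open import Data.Fin.Permutation using (↔⇒≡)
open import Data.Fin.Properties as Finₚ using (_≟_; <-cmp; toℕ<n; toℕ-injective; toℕ-↑ˡ; toℕ-↑ʳ; toℕ-combine; opposite-prop; opposite-involutive; injective⇒≤; punchIn-injective; punchInᵢ≢i; +↔⊎; *↔×)
open import Data.List using (List; []; _∷_; _++_; allFin; filter; length; lookup; map; tabulate)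
open import Data.List.Extrema.Nat using (argmin; f[argmin]≤v⁺)
open import Data.List.Membership.Propositional using (_∈_; lose)
open import Data.List.Membership.Propositional.Properties using (∈-allFin; ∈-filter⁺; ∈-filter⁻; ∈-lookup; ∈-map⁺; ∈-map⁻; ∈-++⁺ˡ; ∈-++⁺ʳ; ∈-++⁻)
open import Data.List.Membership.Propositional.Properties.WithK using (unique∧set⇒bag)
open import Data.List.Properties using (length-++; length-map; length-tabulate; map-++; map-∘; map-cong; map-tabulate; tabulate-cong)
open import Data.List.Relation.Binary.BagAndSetEquality using (∼bag⇒↭)
open import Data.List.Relation.Binary.Permutation.Propositional using (_↭_; ↭-sym; ↭⇒↭ₛ)
open import Data.List.Relation.Binary.Permutation.Propositional.Properties using (map⁺; ∈-resp-↭)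
open import Data.List.Relation.Binary.Permutation.Setoid.Properties using (Unique-resp-↭)
open import Data.List.Relation.Unary.All as All using (All; []; _∷_)
import Data.List.Relation.Unary.All.Properties as Allₚ
open import Data.List.Relation.Unary.AllPairs using (_∷_)
open import Data.List.Relation.Unary.Any using (here; there; index)
open import Data.List.Relation.Unary.Any.Properties using (lookup-index)
open import Data.List.Relation.Unary.Sorted.TotalOrder.Properties using (lookup-mono-≤)
open import Data.List.Relation.Unary.Unique.Propositional using (Unique)
import Data.List.Relation.Unary.Unique.Propositional.Properties as Uniqueₚ
import Data.List.Sort as Sort
open import Data.Maybe using (Maybe; just; nothing)
open import Data.Maybe.Properties using (just-injective)
open import Data.Nat using (zero; suc; _+_; _*_; _<_; _<ᵇ_; s≤s; s≤s⁻¹; z≤n)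
open import Data.Nat.ListAction using (sum)
open import Data.Nat.ListAction.Properties using (sum-++; sum-↭)
open import Data.Nat.Properties hiding (_≟_; <-cmp)
open import Data.Nat.Tactic.RingSolver using (solve-∀)
open import Data.Product using (_×_; _,_; ∃-syntax; proj₁; proj₂)
open import Data.Sum as Sum using (_⊎_; inj₁; inj₂)
open import Data.Sum.Function.Propositional using (_⊎-↔_)
open import Data.Sum.Properties using (inj₁-injective; inj₂-injective)
open import Function.Base using (_∘_; id)
open import Function.Bundles using (_⇔_; _↔_; _⤖_; mk⇔; mk⤖; module Bijection; module Equivalence; module Inverse)
open import Function.Consequences.Propositional using (strictlySurjective⇒surjective)
open import Function.Construct.Identity using (↔-id)
open import Function.Definitions using (Injective)
import Function.Properties.Bijection as ⤖
open import Function.Properties.Inverse using (↔-sym; ↔-trans; ↔⇒⤖)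
open import Level using (0ℓ)
open import Relation.Binary.Bundles using (DecTotalOrder)
import Relation.Binary.Construct.On as On
open import Relation.Binary.Definitions using (tri<; tri≈; tri>)
open import Relation.Binary.PropositionalEquality using (_≡_; _≢_; refl; sym; trans; cong; cong₂; subst; subst₂; setoid; module ≡-Reasoning)
open import Relation.Nullary using (¬_; yes; no; contradiction; recompute)
open import Relation.Nullary.Decidable using (_×-dec_; ¬?)

-- Duplicate-free lists.

lookup-injective : ∀ {A : Set} {xs : List A} → Unique xs → Injective _≡_ _≡_ (lookup xs)
lookup-injective (_ ∷ _)     {zero}  {zero}  _  = refl
lookup-injective (x∉ ∷ _)    {zero}  {suc j} eq = contradiction eq (All.lookup x∉ (∈-lookup j))
lookup-injective (x∉ ∷ _)    {suc i} {zero}  eq = contradiction (sym eq) (All.lookup x∉ (∈-lookup i))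
lookup-injective (_ ∷ uniq)  {suc i} {suc j} eq = cong suc (lookup-injective uniq eq)

-- The position found in `ys` determines the element, and by uniqueness the element determines its
-- position in `xs`. Positions therefore map injectively.
unique⊆⇒length≤ : ∀ {A : Set} {xs ys : List A} → Unique xs → (∀ {x} → x ∈ xs → x ∈ ys) → length xs ≤ length ys
unique⊆⇒length≤ {xs = xs} {ys} uniq xs⊆ys = injective⇒≤ {f = position} position-injective
  where
  position : Fin (length xs) → Fin (length ys)
  position i = index (xs⊆ys (∈-lookup i))

  position-injective : Injective _≡_ _≡_ position
  position-injective {i} {j} eq = lookup-injective uniq (begin
    lookup xs i            ≡⟨ lookup-index (xs⊆ys (∈-lookup i)) ⟩
    lookup ys (position i) ≡⟨ cong (lookup ys) eq ⟩
    lookup ys (position j) ≡⟨ lookup-index (xs⊆ys (∈-lookup j)) ⟨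
    lookup xs j            ∎)
    where open ≡-Reasoning

lookup-⤖ : ∀ {A : Set} {xs : List A} → Unique xs → (∀ x → x ∈ xs) → Fin (length xs) ⤖ A
lookup-⤖ {xs = xs} uniq full = mk⤖
  (lookup-injective uniq , strictlySurjective⇒surjective λ x → index (full x) , sym (lookup-index (full x)))

sum≤length* : ∀ {b} (xs : List ℕ) → All (_≤ b) xs → sum xs ≤ length xs * b
sum≤length* []       []         = z≤n
sum≤length* (x ∷ xs) (x≤ ∷ xs≤) = +-mono-≤ x≤ (sum≤length* xs xs≤)

-- Finite sums and triangular numbers.

∑ : ∀ {n} → (Fin n → ℕ) → ℕ
∑ f = sum (tabulate f)

∑-cong : ∀ {n} {f g : Fin n → ℕ} → (∀ i → f i ≡ g i) → ∑ f ≡ ∑ g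
∑-cong eq = cong sum (tabulate-cong eq)

sum-map-allFin : ∀ {A : Set} {n} (f : A → ℕ) (h : Fin n → A) → sum (map f (map h (allFin n))) ≡ ∑ (f ∘ h)
sum-map-allFin {n = n} f h = cong sum (trans (sym (map-∘ {g = f} {f = h} (allFin n))) (map-tabulate id (f ∘ h)))

∑-const : ∀ n a → ∑ {n} (λ _ → a) ≡ n * a
∑-const zero    a = refl
∑-const (suc n) a = cong (a +_) (∑-const n a)

∑-+ : ∀ {n} (f g : Fin n → ℕ) → ∑ (λ i → f i + g i) ≡ ∑ f + ∑ g
∑-+ {zero}  f g = refl
∑-+ {suc n} f g = begin
  f zero + g zero + ∑ (λ i → f (suc i) + g (suc i)) ≡⟨ cong (f zero + g zero +_) (∑-+ (f ∘ suc) (g ∘ suc)) ⟩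
  f zero + g zero + (∑ (f ∘ suc) + ∑ (g ∘ suc))     ≡⟨ interchange (f zero) (g zero) _ _ ⟩
  ∑ f + ∑ g                                         ∎
  where
  open ≡-Reasoning
  interchange : ∀ a b c d → a + b + (c + d) ≡ a + c + (b + d)
  interchange = solve-∀

∑-*ˡ : ∀ {n} a (f : Fin n → ℕ) → ∑ (λ i → a * f i) ≡ a * ∑ f
∑-*ˡ {zero}  a f = sym (*-zeroʳ a)
∑-*ˡ {suc n} a f = trans (cong (a * f zero +_) (∑-*ˡ a (f ∘ suc))) (sym (*-distribˡ-+ a (f zero) _))

triangle : ℕ → ℕ
triangle n = ∑ {n} toℕ

triangle-suc : ∀ n → triangle (suc n) ≡ n + triangle n
triangle-suc n = trans (∑-+ {n} (λ _ → 1) toℕ) (cong (_+ triangle n) (trans (∑-const n 1) (*-identityʳ n)))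

-- The subtraction in T(n) = n(n - 1)/2 is moved to the other side.
triangle-closed : ∀ n → triangle n + triangle n + n ≡ n * n
triangle-closed zero    = refl
triangle-closed (suc n) = begin
  triangle (suc n) + triangle (suc n) + suc n   ≡⟨ cong (λ x → x + x + suc n) (triangle-suc n) ⟩
  n + triangle n + (n + triangle n) + suc n     ≡⟨ regroup n (triangle n) ⟩
  triangle n + triangle n + n + (n + suc n)     ≡⟨ cong (_+ (n + suc n)) (triangle-closed n) ⟩
  n * n + (n + suc n)                           ≡⟨ square n ⟩
  suc n * suc n                                 ∎
  where
  open ≡-Reasoning
  regroup : ∀ n x → n + x + (n + x) + suc n ≡ x + x + n + (n + suc n)
  regroup = solve-∀
  square : ∀ n → n * n + (n + suc n) ≡ suc n * suc n
  square = solve-∀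

-- The length is given as `r + w` so that induction on `r` peels off one summand at a time:
-- `toℕ (suc j) <ᵇ suc r` computes to `toℕ j <ᵇ r`.
∑-threshold : ∀ r w x y → ∑ {r + w} (λ j → if toℕ j <ᵇ r then x else y) ≡ r * x + w * y
∑-threshold zero    w x y = ∑-const w y
∑-threshold (suc r) w x y = trans (cong (x +_) (∑-threshold r w x y)) (sym (+-assoc x (r * x) (w * y)))

-- For t = 0 the two sides differ by exactly one, so the P * P gained from the
-- reversed rows is needed.
surplus : ∀ P t T → let p = suc P; q = p + p + t in
          T + T + q ≡ q * q → q * (p * p) < q + (p * T + P * P)
surplus P zero T eq = ≤-reflexive (begin
  suc (q * (p * p))              ≡⟨ cong suc (lhs P) ⟩
  suc (p * ((p + p) * p))        ≡⟨ cong (λ x → suc (p * x)) half ⟨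
  suc (p * (T + p))              ≡⟨ rhs P T ⟩
  q + (p * T + P * P)            ∎)
  where
  open ≡-Reasoning
  p q : ℕ
  p = suc P
  q = p + p + 0
  lhs : ∀ P → (suc P + suc P + 0) * (suc P * suc P) ≡ suc P * ((suc P + suc P) * suc P)
  lhs = solve-∀
  rhs : ∀ P T → suc (suc P * (T + suc P)) ≡ suc P + suc P + 0 + (suc P * T + P * P)
  rhs = solve-∀
  double : ∀ P T → 2 * (T + suc P) ≡ T + T + (suc P + suc P + 0)
  double = solve-∀
  square : ∀ P → (suc P + suc P + 0) * (suc P + suc P + 0) ≡ 2 * ((suc P + suc P) * suc P)
  square = solve-∀
  half : T + p ≡ (p + p) * p
  -- For `q = 2p` the hypothesis reads `2 (T + p) = 2 (2p * p)`.
  half = *-cancelˡ-≡ _ _ 2 (trans (double P T) (trans eq (square P)))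
surplus P (suc t) T eq = begin-strict
  q * (p * p)          ≡⟨ assoc q p ⟩
  p * (q * p)          ≤⟨ *-monoʳ-≤ p qp≤T ⟩
  p * T                ≤⟨ m≤m+n (p * T) (P * P) ⟩
  p * T + P * P        <⟨ m<n+m (p * T + P * P) {q} (s≤s z≤n) ⟩
  q + (p * T + P * P)  ∎
  where
  open ≤-Reasoning
  p q : ℕ
  p = suc P
  q = p + p + suc t
  assoc : ∀ q p → q * (p * p) ≡ p * (q * p)
  assoc = solve-∀
  regroup : ∀ P t q → 2 * (q * suc P) + q * t + q ≡ q * (suc P + suc P + suc t)
  regroup = solve-∀
  double : ∀ T → T + T ≡ 2 * T
  double = solve-∀
  qp≤T : q * p ≤ T
  -- Here `q = 2p + t + 1`, so `2T = q (q - 1) = 2qp + qt`.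
  qp≤T = *-cancelˡ-≤ 2 (begin
    2 * (q * p)          ≤⟨ m≤m+n _ (q * t) ⟩
    2 * (q * p) + q * t  ≡⟨ +-cancelʳ-≡ q _ _ (trans (regroup P t q) (sym eq)) ⟩
    T + T                ≡⟨ double T ⟩
    2 * T                ∎)

-- Minima and sorting.

abstract
  minimiser : ∀ {k} (f : Fin (suc k) → ℕ) → ∃[ a ] ∀ b → f a ≤ f b
  minimiser {k} f = argmin f zero (allFin (suc k)) ,
    λ b → f[argmin]≤v⁺ {f = f} {v = f b} zero (allFin (suc k)) (inj₂ (lose (∈-allFin b) ≤-refl))

  sortOn : ∀ {A : Set} (f : A → ℕ) (xs : List A) →
           ∃[ ys ] ys ↭ xs × (∀ {i j} → i Fin.≤ j → f (lookup ys i) ≤ f (lookup ys j))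
  sortOn f xs = sort xs , sort-↭ xs , lookup-mono-≤ (DecTotalOrder.totalOrder O) (sort-↗ xs)
    where
    O : DecTotalOrder 0ℓ 0ℓ 0ℓ
    O = On.decTotalOrder ≤-decTotalOrder f
    open Sort O using (sort; sort-↭; sort-↗)

-- Reversing a row.

flip : ∀ {p} → Bool → Fin p → Fin p
flip b i = if b then opposite i else i

flip-involutive : ∀ {p} b (i : Fin p) → flip b (flip b i) ≡ i
flip-involutive true  i = opposite-involutive i
flip-involutive false i = refl

-- Moves the conditional to natural numbers, the form that `∑-threshold` sums.
toℕ-flip : ∀ {p} b (i : Fin p) → toℕ (flip b i) ≡ (if b then toℕ (opposite i) else toℕ i)
toℕ-flip true  i = refl
toℕ-flip false i = refl

-- A forward and a backward row together contribute the constant `P`, whichever vertex of A is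
-- considered.
toℕ+opposite : ∀ {P} (i : Fin (suc P)) → toℕ i + toℕ (opposite i) ≡ P
toℕ+opposite {P} i = trans (cong (toℕ i +_) (opposite-prop i)) (m+[n∸m]≡n (s≤s⁻¹ (toℕ<n i)))

-- Edges and incidence.

module _ (G : Graph) where
  open Graph G

  -- The proofs stored in an edge are irrelevant; decidability of the two relations recovers usable
  -- ones.
  src<tgt : ∀ e → src e Fin.< tgt e
  src<tgt (edge u v u<v _) = recompute (u Finₚ.<? v) u<v

  src~tgt : ∀ e → src e ~ tgt e
  src~tgt (edge u v _ u~v) = recompute (u ~? v) u~v

  -- Both edges have the endpoints `u` and `v`. Opposite orientations would give both `u < v` and
  -- `v < u`, and with equal orientations the edges agree because their proof fields are irrelevant.
  incident-unique : ∀ {u v} (e e′ : Edge) → u ≢ v → Incident u e → Incident v e → Incident u e′ → Incident v e′ → e ≡ e′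
  incident-unique e e′ u≢v (inj₁ refl) (inj₁ refl) _ _ = contradiction refl u≢v
  incident-unique e e′ u≢v (inj₂ refl) (inj₂ refl) _ _ = contradiction refl u≢v
  incident-unique e e′ u≢v _ _ (inj₁ refl) (inj₁ refl) = contradiction refl u≢v
  incident-unique e e′ u≢v _ _ (inj₂ refl) (inj₂ refl) = contradiction refl u≢v
  incident-unique e e′ u≢v (inj₁ refl) (inj₂ refl) (inj₁ refl) (inj₂ refl) = refl
  incident-unique e e′ u≢v (inj₂ refl) (inj₁ refl) (inj₂ refl) (inj₁ refl) = refl
  incident-unique e e′ u≢v (inj₁ refl) (inj₂ refl) (inj₂ refl) (inj₁ refl) = contradiction (src<tgt e′) (Finₚ.<-asym (src<tgt e))
  incident-unique e e′ u≢v (inj₂ refl) (inj₁ refl) (inj₁ refl) (inj₂ refl) = contradiction (src<tgt e′) (Finₚ.<-asym (src<tgt e))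

  link : ∀ u v → u ~ v → Edge
  link u v u~v with <-cmp u v
  ... | tri< u<v _ _ = edge u v u<v u~v
  ... | tri≈ _ u≡v _ = contradiction u~v (~-irrefl u≡v)
  ... | tri> _ _ v<u = edge v u v<u (~-sym u~v)

  incident-link : ∀ {u v} (u~v : u ~ v) → Incident u (link u v u~v) × Incident v (link u v u~v)
  incident-link {u} {v} u~v with <-cmp u v
  ... | tri< _ _ _   = inj₁ refl , inj₂ refl
  ... | tri≈ _ u≡v _ = contradiction u~v (~-irrefl u≡v)
  ... | tri> _ _ _   = inj₂ refl , inj₁ refl

  incident-link⁻ : ∀ {u v w} (u~v : u ~ v) → Incident w (link u v u~v) → w ≡ u ⊎ w ≡ v
  incident-link⁻ {u} {v} u~v inc with <-cmp u v
  ... | tri< _ _ _   = inc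
  ... | tri≈ _ u≡v _ = contradiction u~v (~-irrefl u≡v)
  ... | tri> _ _ _   = Sum.swap inc

  ~⇒≢ : ∀ {u v} → u ~ v → u ≢ v
  ~⇒≢ u~v u≡v = ~-irrefl u≡v u~v

  -- Labelings and vertex sums read off from an encoding of the edges.

  module _ {C : Set} {N : ℕ} (g : C ⤖ Edge) (enc : C ↔ Fin N) where
    open Bijection g using () renaming (to to g→)
    open Inverse enc using () renaming (to to enc→)

    numbering : Edge ⤖ Fin N
    numbering = ⤖.trans (⤖.sym-≡ g) (↔⇒⤖ enc)

    numbering-∘ : ∀ x → Bijection.to numbering (g→ x) ≡ enc→ x
    numbering-∘ x = cong enc→ (Bijection.injective g (proj₂ (Bijection.strictlySurjective g (g→ x))))

    -- The edges are counted without any formula: `edges` is a bijective enumeration, so composing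
    -- it with `numbering` gives a bijection between `Fin m` and `Fin N`.
    N≡m : N ≡ m
    N≡m = ↔⇒≡ (⤖.⤖⇒↔ (⤖.sym-≡ (⤖.trans (lookup-⤖ edges-unique ∈-edges) numbering)))

    abstract
      labelingFrom : ∃[ φ ] ∀ x → label φ (g→ x) ≡ suc (toℕ (enc→ x))
      labelingFrom = transport N≡m numbering (λ x → cong (suc ∘ toℕ) (numbering-∘ x))
        where
        -- The size is generalised to a variable `M`, so that the equation with `m` can be matched
        -- with `refl`.
        transport : ∀ {M} {f : C → ℕ} → M ≡ m → (ψ : Edge ⤖ Fin M) →
                    (∀ x → suc (toℕ (Bijection.to ψ (g→ x))) ≡ f x) → ∃[ φ ] ∀ x → label φ (g→ x) ≡ f x
        transport refl ψ eq = ψ , eq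

    -- The list of edges at `v` and the image of `X` are duplicate-free with the same members, hence
    -- permutations of each other, and sums are invariant under permutation.
    vertexSum-via : ∀ (φ : Labeling) {f : C → ℕ} → (∀ x → label φ (g→ x) ≡ f x) →
                    ∀ v (X : List C) → Unique X → (∀ {x} → x ∈ X → Incident v (g→ x)) →
                    (∀ {x} → Incident v (g→ x) → x ∈ X) → vertexSum φ v ≡ sum (map f X)
    vertexSum-via φ {f} eq v X uniq sound complete = begin
      vertexSum φ v                    ≡⟨ sum-↭ (map⁺ (label φ) (∼bag⇒↭ (unique∧set⇒bag (Uniqueₚ.filter⁺ (incident? v) edges-unique) (Uniqueₚ.map⁺ (Bijection.injective g) uniq) (mk⇔ to from)))) ⟩
      sum (map (label φ) (map g→ X))   ≡⟨ cong sum (map-∘ X) ⟨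
      sum (map (label φ ∘ g→) X)       ≡⟨ cong sum (map-cong eq X) ⟩
      sum (map f X)                    ∎
      where
      open ≡-Reasoning
      to : ∀ {e} → e ∈ filter (incident? v) edges → e ∈ map g→ X
      to {e} e∈ with x , refl ← Bijection.strictlySurjective g e = ∈-map⁺ g→ (complete (proj₂ (∈-filter⁻ (incident? v) {xs = edges} e∈)))
      from : ∀ {e} → e ∈ map g→ X → e ∈ filter (incident? v) edges
      from e∈ with x , x∈X , refl ← ∈-map⁻ g→ e∈ = ∈-filter⁺ (incident? v) (∈-edges (g→ x)) (sound x∈X)

  -- Splitting the graph into A (`α`), B (`β`) and the edges inside B (`γ`).

  record Decomposition (p q μ : ℕ) : Set where
    field
      α     : Fin p → Vertex
      β     : Fin q → Vertex
      γ     : Fin μ → Edge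
      α-inj : Injective _≡_ _≡_ α
      β-inj : Injective _≡_ _≡_ β
      γ-inj : Injective _≡_ _≡_ γ
      cover : ∀ v → (∃[ i ] v ≡ α i) ⊎ (∃[ j ] v ≡ β j)
      α≁α   : ∀ i i′ → ¬ (α i ~ α i′)
      β~α   : ∀ j i → β j ~ α i
      γ-avoids-α : ∀ x i → ¬ Incident (α i) (γ x)
      γ-complete : ∀ e → (∀ i → ¬ Incident (α i) e) → ∃[ x ] γ x ≡ e

    inner : Vertex → List (Fin μ)
    inner v = filter (λ x → incident? v (γ x)) (allFin μ)

    -- The partial sum at `v`, since `γ x` is going to carry the label `suc (toℕ x)`.
    innerSum : Vertex → ℕ
    innerSum v = sum (map (suc ∘ toℕ) (inner v))

    field
      β-sorted  : ∀ {j j′} → j Fin.≤ j′ → innerSum (β j) ≤ innerSum (β j′)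
      -- In the application, the class of `β j` lies in B and has at least `p` vertices, which
      -- leaves at most `q - p` neighbours inside B.
      β-inner-≤ : ∀ j → length (inner (β j)) + p ≤ q

  -- The antimagic labeling of a decomposition.

  module _ {P t μ : ℕ} (D : Decomposition (suc P) (suc P + suc P + t) μ) where
    open Decomposition D

    private
      -- Writing `p = suc P` and `q = p + p + t` builds in `1 ≤ p` and `2p ≤ q` and avoids
      -- subtraction: `P` is `p - 1`, and `suc (suc t)` is `q - 2p + 2`.
      p q : ℕ
      p = suc P
      q = p + p + t

    α≢β : ∀ {i j} → α i ≢ β j
    α≢β {i} {j} eq = ~⇒≢ (β~α j i) (sym eq)

    -- A code is a place in the order of labels: first the edges inside B, then the rows one after
    -- another. In `inj₂ (j , i)` the `i` is a position within row `j`; which vertex of A stands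
    -- there is decided by `flip` in `decode`.
    Code : Set
    Code = Fin μ ⊎ (Fin q × Fin p)

    enc : Code ↔ Fin (μ + q * p)
    enc = ↔-sym (↔-trans +↔⊎ (↔-id (Fin μ) ⊎-↔ *↔×))

    value : Code → ℕ
    value x = suc (toℕ (Inverse.to enc x))

    value-inner : ∀ x → value (inj₁ x) ≡ suc (toℕ x)
    value-inner x = cong suc (toℕ-↑ˡ x (q * p))

    value-cross : ∀ j i → value (inj₂ (j , i)) ≡ suc μ + (p * toℕ j + toℕ i)
    value-cross j i = cong suc (trans (toℕ-↑ʳ μ (combine j i)) (cong (μ +_) (toℕ-combine j i)))

    value≤ : ∀ x → value x ≤ μ + q * p
    value≤ x = toℕ<n (Inverse.to enc x)

    -- The number `P` of reversed rows is tight. If `t = 0`, then `p` reversed rows would make all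
    -- sums at A equal, while fewer than `P` would leave the sum at `α zero` no larger than the
    -- bound for B.
    reversed : Fin q → Bool
    reversed j = toℕ j <ᵇ P

    cross : Fin q → Fin p → Edge
    cross j i = link (β j) (α i) (β~α j i)

    decode : Code → Edge
    decode (inj₁ x)       = γ x
    decode (inj₂ (j , i)) = cross j (flip (reversed j) i)

    cross-β : ∀ {j j′ i} → Incident (β j) (cross j′ i) → j ≡ j′
    cross-β {j′ = j′} {i} inc with incident-link⁻ (β~α j′ i) inc
    ... | inj₁ eq = β-inj eq
    ... | inj₂ eq = contradiction (sym eq) α≢β

    cross-α : ∀ {j i i′} → Incident (α i) (cross j i′) → i ≡ i′
    cross-α {j} {i′ = i′} inc with incident-link⁻ (β~α j i′) inc
    ... | inj₁ eq = contradiction eq α≢β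
    ... | inj₂ eq = α-inj eq

    β-incident-cross : ∀ j i → Incident (β j) (cross j i)
    β-incident-cross j i = proj₁ (incident-link (β~α j i))

    α-incident-cross : ∀ j i → Incident (α i) (cross j i)
    α-incident-cross j i = proj₂ (incident-link (β~α j i))

    flip≡⇒≡flip : ∀ b {i i′ : Fin p} → i ≡ flip b i′ → i′ ≡ flip b i
    flip≡⇒≡flip b {i′ = i′} refl = sym (flip-involutive b i′)

    -- Edges of `γ` avoid A and cross edges meet it. Equal cross edges share their end in B, hence
    -- the row, and then their end in A, hence the position, as `flip` is invertible.
    decode-injective : Injective _≡_ _≡_ decode
    decode-injective {inj₁ x} {inj₁ y} eq = cong inj₁ (γ-inj eq)
    decode-injective {inj₁ x} {inj₂ (j , i)} eq =
      contradiction (subst (Incident _) (sym eq) (α-incident-cross j _)) (γ-avoids-α x _)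
    decode-injective {inj₂ (j , i)} {inj₁ x} eq =
      contradiction (subst (Incident _) eq (α-incident-cross j _)) (γ-avoids-α x _)
    decode-injective {inj₂ (j , i)} {inj₂ (j′ , i′)} eq
      with refl ← cross-β (subst (Incident (β j)) eq (β-incident-cross j _)) =
      cong (λ k → inj₂ (j , k)) (trans
        (flip≡⇒≡flip (reversed j) (sym (cross-α (subst (Incident _) eq (α-incident-cross j _)))))
        (flip-involutive (reversed j) i′))

    decode-cross : ∀ e {i j} → Incident (β j) e → Incident (α i) e → ∃[ x ] decode x ≡ e
    decode-cross e {i} {j} βj∈e αi∈e = inj₂ (j , flip (reversed j) i) ,
      trans (cong (cross j) (flip-involutive (reversed j) i))
            (incident-unique _ e (~⇒≢ (β~α j i)) (β-incident-cross j i) (α-incident-cross j i) βj∈e αi∈e)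

    decode-surjective : ∀ e → ∃[ x ] decode x ≡ e
    decode-surjective e with cover (src e) | cover (tgt e)
    ... | inj₁ (i , s≡) | inj₁ (i′ , t≡) = contradiction (subst₂ _~_ s≡ t≡ (src~tgt e)) (α≁α i i′)
    ... | inj₁ (i , s≡) | inj₂ (j , t≡)  = decode-cross e (inj₂ (sym t≡)) (inj₁ (sym s≡))
    ... | inj₂ (j , s≡) | inj₁ (i , t≡)  = decode-cross e (inj₁ (sym s≡)) (inj₂ (sym t≡))
    ... | inj₂ (j , s≡) | inj₂ (j′ , t≡) =
      let x , eq = γ-complete e λ { i (inj₁ α≡s) → α≢β (trans α≡s s≡) ; i (inj₂ α≡t) → α≢β (trans α≡t t≡) }
      in inj₁ x , eq

    decode-⤖ : Code ⤖ Edge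
    decode-⤖ = mk⤖ (decode-injective , strictlySurjective⇒surjective decode-surjective)

    φ : Labeling
    φ = proj₁ (labelingFrom decode-⤖ enc)

    φ-value : ∀ x → label φ (decode x) ≡ value x
    φ-value = proj₂ (labelingFrom decode-⤖ enc)

    offset : Fin p → ℕ
    offset i = P * P + suc (suc t) * toℕ i

    ∑-flip : ∀ i → ∑ (λ j → toℕ (flip (reversed j) i)) ≡ offset i
    ∑-flip i = begin
      ∑ (λ j → toℕ (flip (reversed j) i))                ≡⟨ ∑-cong (λ j → toℕ-flip (reversed j) i) ⟩
      ∑ {q} (λ j → if toℕ j <ᵇ P then i′ else toℕ i)     ≡⟨ cong (λ n → ∑ {n} (λ j → if toℕ j <ᵇ P then i′ else toℕ i)) (split P t) ⟩
      ∑ {P + w} (λ j → if toℕ j <ᵇ P then i′ else toℕ i) ≡⟨ ∑-threshold P w i′ (toℕ i) ⟩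
      P * i′ + w * toℕ i                                 ≡⟨ regroup P t (toℕ i) i′ ⟩
      P * (toℕ i + i′) + suc (suc t) * toℕ i             ≡⟨ cong (λ x → P * x + suc (suc t) * toℕ i) (toℕ+opposite i) ⟩
      offset i                                           ∎
      where
      open ≡-Reasoning
      i′ w : ℕ
      i′ = toℕ (opposite i)
      -- `w` counts the forward rows. `P` of them pair up with the reversed rows, each pair
      -- contributing `P`; the remaining `suc (suc t)` contribute `toℕ i` each.
      w = P + suc (suc t)
      split : ∀ P t → suc P + suc P + t ≡ P + (P + suc (suc t))
      split = solve-∀
      regroup : ∀ P t x y → P * y + (P + suc (suc t)) * x ≡ P * (x + y) + suc (suc t) * x
      regroup = solve-∀

    -- As `flip` is an involution, `α i` stands at position `flip (reversed j) i` of row `j`.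
    column : Fin p → List Code
    column i = map (λ j → inj₂ (j , flip (reversed j) i)) (allFin q)

    vertexSum-α : ∀ i → vertexSum φ (α i) ≡ q * suc μ + (p * triangle q + offset i)
    vertexSum-α i = begin
      vertexSum φ (α i)                                                   ≡⟨ vertexSum-via decode-⤖ enc φ φ-value (α i) (column i) (Uniqueₚ.map⁺ (cong proj₁ ∘ inj₂-injective) (Uniqueₚ.allFin⁺ q)) sound complete ⟩
      sum (map value (column i))                                          ≡⟨ sum-map-allFin value (λ j → inj₂ (j , flip (reversed j) i)) ⟩
      ∑ (λ j → value (inj₂ (j , flip (reversed j) i)))                    ≡⟨ ∑-cong (λ j → value-cross j (flip (reversed j) i)) ⟩
      ∑ {q} (λ j → suc μ + (p * toℕ j + toℕ (flip (reversed j) i)))       ≡⟨ ∑-+ {q} (λ _ → suc μ) (λ j → p * toℕ j + toℕ (flip (reversed j) i)) ⟩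
      ∑ {q} (λ _ → suc μ) + ∑ {q} (λ j → p * toℕ j + toℕ (flip (reversed j) i)) ≡⟨ cong₂ _+_ (∑-const q (suc μ)) (∑-+ {q} (λ j → p * toℕ j) (λ j → toℕ (flip (reversed j) i))) ⟩
      q * suc μ + (∑ {q} (λ j → p * toℕ j) + ∑ (λ j → toℕ (flip (reversed j) i))) ≡⟨ cong (q * suc μ +_) (cong₂ _+_ (∑-*ˡ {q} p toℕ) (∑-flip i)) ⟩
      q * suc μ + (p * triangle q + offset i)                             ∎
      where
      open ≡-Reasoning
      sound : ∀ {x} → x ∈ column i → Incident (α i) (decode x)
      sound x∈ with j , _ , refl ← ∈-map⁻ _ x∈ =
        subst (λ k → Incident (α i) (cross j k)) (sym (flip-involutive (reversed j) i)) (α-incident-cross j i)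
      complete : ∀ {x} → Incident (α i) (decode x) → x ∈ column i
      complete {inj₁ x} inc = contradiction inc (γ-avoids-α x i)
      complete {inj₂ (j , k)} inc with refl ← flip≡⇒≡flip (reversed j) (cross-α inc) = ∈-map⁺ _ (∈-allFin j)

    row : Fin q → List Code
    row j = map (λ i → inj₂ (j , i)) (allFin p)

    rowSum : Fin q → ℕ
    rowSum j = sum (map value (row j))

    -- Reversing a row only permutes its labels among the edges at `β j`, so `flip` leaves no trace
    -- in the sum.
    vertexSum-β : ∀ j → vertexSum φ (β j) ≡ innerSum (β j) + rowSum j
    vertexSum-β j = begin
      vertexSum φ (β j)                                     ≡⟨ vertexSum-via decode-⤖ enc φ φ-value (β j) (xs ++ row j) uniq sound complete ⟩
      sum (map value (xs ++ row j))                         ≡⟨ cong sum (map-++ value xs (row j)) ⟩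
      sum (map value xs ++ map value (row j))               ≡⟨ sum-++ (map value xs) _ ⟩
      sum (map value xs) + rowSum j                         ≡⟨ cong (λ ys → sum ys + rowSum j) (map-∘ (inner (β j))) ⟨
      sum (map (value ∘ inj₁) (inner (β j))) + rowSum j     ≡⟨ cong (λ ys → sum ys + rowSum j) (map-cong value-inner (inner (β j))) ⟩
      innerSum (β j) + rowSum j                             ∎
      where
      open ≡-Reasoning
      xs : List Code
      xs = map inj₁ (inner (β j))
      uniq : Unique (xs ++ row j)
      uniq = Uniqueₚ.++⁺
        (Uniqueₚ.map⁺ inj₁-injective (Uniqueₚ.filter⁺ _ (Uniqueₚ.allFin⁺ μ)))
        (Uniqueₚ.map⁺ (cong proj₂ ∘ inj₂-injective) (Uniqueₚ.allFin⁺ p))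
        disjoint
        where
        disjoint : ∀ {x} → ¬ (x ∈ xs × x ∈ row j)
        disjoint (x∈xs , x∈row) with _ , _ , refl ← ∈-map⁻ inj₁ x∈xs | _ , _ , () ← ∈-map⁻ _ x∈row
      sound : ∀ {x} → x ∈ xs ++ row j → Incident (β j) (decode x)
      sound x∈ with ∈-++⁻ xs x∈
      ... | inj₁ x∈xs with y , y∈ , refl ← ∈-map⁻ inj₁ x∈xs =
        proj₂ (∈-filter⁻ (λ x → incident? (β j) (γ x)) {xs = allFin μ} y∈)
      ... | inj₂ x∈row with i , _ , refl ← ∈-map⁻ _ x∈row = β-incident-cross j _
      complete : ∀ {x} → Incident (β j) (decode x) → x ∈ xs ++ row j
      complete {inj₁ x} inc = ∈-++⁺ˡ (∈-map⁺ inj₁ (∈-filter⁺ (λ x → incident? (β j) (γ x)) (∈-allFin x) inc))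
      complete {inj₂ (j′ , i)} inc with refl ← cross-β inc = ∈-++⁺ʳ xs (∈-map⁺ _ (∈-allFin i))

    rowSum-formula : ∀ j → rowSum j ≡ p * suc μ + (p * (p * toℕ j) + triangle p)
    rowSum-formula j = begin
      rowSum j                                             ≡⟨ sum-map-allFin value (λ i → inj₂ (j , i)) ⟩
      ∑ (λ i → value (inj₂ (j , i)))                       ≡⟨ ∑-cong (value-cross j) ⟩
      ∑ {p} (λ i → suc μ + (p * toℕ j + toℕ i))            ≡⟨ ∑-+ {p} (λ _ → suc μ) (λ i → p * toℕ j + toℕ i) ⟩
      ∑ {p} (λ _ → suc μ) + ∑ {p} (λ i → p * toℕ j + toℕ i) ≡⟨ cong₂ _+_ (∑-const p (suc μ)) (∑-+ {p} (λ _ → p * toℕ j) toℕ) ⟩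
      p * suc μ + (∑ {p} (λ _ → p * toℕ j) + triangle p)   ≡⟨ cong (λ x → p * suc μ + (x + triangle p)) (∑-const p (p * toℕ j)) ⟩
      p * suc μ + (p * (p * toℕ j) + triangle p)           ∎
      where open ≡-Reasoning

    rowSum-mono : ∀ {j j′} → j Fin.< j′ → rowSum j < rowSum j′
    rowSum-mono {j} {j′} j<j′ = begin-strict
      rowSum j                                    ≡⟨ rowSum-formula j ⟩
      p * suc μ + (p * (p * toℕ j) + triangle p)  <⟨ +-monoʳ-< (p * suc μ) (+-monoˡ-< (triangle p) (*-monoʳ-< p (*-monoʳ-< p j<j′))) ⟩
      p * suc μ + (p * (p * toℕ j′) + triangle p) ≡⟨ rowSum-formula j′ ⟨
      rowSum j′                                   ∎
      where open ≤-Reasoning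

    -- Sorting makes the partial sums weakly increasing; strictness comes from the rows.
    vertexSum-β-mono : ∀ {j j′} → j Fin.< j′ → vertexSum φ (β j) < vertexSum φ (β j′)
    vertexSum-β-mono {j} {j′} j<j′ = begin-strict
      vertexSum φ (β j)           ≡⟨ vertexSum-β j ⟩
      innerSum (β j) + rowSum j   <⟨ +-mono-≤-< (β-sorted (<⇒≤ j<j′)) (rowSum-mono j<j′) ⟩
      innerSum (β j′) + rowSum j′ ≡⟨ vertexSum-β j′ ⟨
      vertexSum φ (β j′)          ∎
      where open ≤-Reasoning

    -- Each of the `l` labels from inside B is at most `μ`, and each of the `p` cross labels is at
    -- most the largest label `μ + q * p`. Then `l + p ≤ q` absorbs the multiples of `μ`.
    vertexSum-β≤ : ∀ j → vertexSum φ (β j) ≤ q * μ + q * (p * p)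
    vertexSum-β≤ j = begin
      vertexSum φ (β j)                    ≡⟨ vertexSum-β j ⟩
      innerSum (β j) + rowSum j            ≤⟨ +-mono-≤ innerSum≤ rowSum≤ ⟩
      l * μ + p * (μ + q * p)              ≡⟨ regroup l p q μ ⟩
      (l + p) * μ + q * (p * p)            ≤⟨ +-monoˡ-≤ _ (*-monoˡ-≤ μ (β-inner-≤ j)) ⟩
      q * μ + q * (p * p)                  ∎
      where
      open ≤-Reasoning
      l : ℕ
      l = length (inner (β j))
      regroup : ∀ l p q μ → l * μ + p * (μ + q * p) ≡ (l + p) * μ + q * (p * p)
      regroup = solve-∀
      innerSum≤ : innerSum (β j) ≤ l * μ
      innerSum≤ = subst (λ n → innerSum (β j) ≤ n * μ) (length-map (suc ∘ toℕ) (inner (β j)))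
        (sum≤length* _ (Allₚ.map⁺ (All.universal toℕ<n (inner (β j)))))
      rowSum≤ : rowSum j ≤ p * (μ + q * p)
      rowSum≤ = subst (λ l → rowSum j ≤ l * (μ + q * p))
        (trans (length-map value (row j)) (trans (length-map (λ i → inj₂ (j , i)) (allFin p)) (length-tabulate {n = p} id)))
        (sum≤length* (map value (row j)) (Allₚ.map⁺ (All.universal value≤ (row j))))

    -- The sum at `α i` is at least the one with offset `P * P`, attained at `i = 0`. Once `q * μ`
    -- is cancelled, comparing this with the bound for B is exactly `surplus`.
    β<α : ∀ j i → vertexSum φ (β j) < vertexSum φ (α i)
    β<α j i = begin-strict
      vertexSum φ (β j)                            ≤⟨ vertexSum-β≤ j ⟩
      q * μ + q * (p * p)                          <⟨ +-monoʳ-< (q * μ) (surplus P t (triangle q) (triangle-closed q)) ⟩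
      q * μ + (q + (p * triangle q + P * P))       ≤⟨ +-monoʳ-≤ (q * μ) (+-monoʳ-≤ q (+-monoʳ-≤ (p * triangle q) (m≤m+n (P * P) _))) ⟩
      q * μ + (q + (p * triangle q + offset i))    ≡⟨ regroup q μ _ ⟩
      q * suc μ + (p * triangle q + offset i)      ≡⟨ vertexSum-α i ⟨
      vertexSum φ (α i)                            ∎
      where
      open ≤-Reasoning
      regroup : ∀ q μ x → q * μ + (q + x) ≡ q * suc μ + x
      regroup = solve-∀

    -- Only the term `suc (suc t) * toℕ i` depends on `i`, and its factor is positive.
    vertexSum-α-injective : ∀ {i i′} → vertexSum φ (α i) ≡ vertexSum φ (α i′) → i ≡ i′
    vertexSum-α-injective {i} {i′} eq = toℕ-injective (*-cancelˡ-≡ _ _ (suc (suc t)) (+-cancelˡ-≡ (P * P) _ _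
      (+-cancelˡ-≡ (p * triangle q) _ _ (+-cancelˡ-≡ (q * suc μ) _ _ (trans (sym (vertexSum-α i)) (trans eq (vertexSum-α i′)))))))

    vertexSum-β-injective : ∀ {j j′} → vertexSum φ (β j) ≡ vertexSum φ (β j′) → j ≡ j′
    vertexSum-β-injective {j} {j′} eq with <-cmp j j′
    ... | tri< j<j′ _ _ = contradiction eq (<⇒≢ (vertexSum-β-mono j<j′))
    ... | tri≈ _ j≡j′ _ = j≡j′
    ... | tri> _ _ j′<j = contradiction (sym eq) (<⇒≢ (vertexSum-β-mono j′<j))

    φ-antimagic : IsAntimagic φ
    φ-antimagic {u} {v} = cases (cover u) (cover v)
      where
      cases : ∀ {u v} → (∃[ i ] u ≡ α i) ⊎ (∃[ j ] u ≡ β j) → (∃[ i ] v ≡ α i) ⊎ (∃[ j ] v ≡ β j) →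
              vertexSum φ u ≡ vertexSum φ v → u ≡ v
      cases (inj₁ (i , refl)) (inj₁ (i′ , refl)) eq = cong α (vertexSum-α-injective eq)
      cases (inj₁ (i , refl)) (inj₂ (j , refl))  eq = contradiction (sym eq) (<⇒≢ (β<α j i))
      cases (inj₂ (j , refl)) (inj₁ (i , refl))  eq = contradiction eq (<⇒≢ (β<α j i))
      cases (inj₂ (j , refl)) (inj₂ (j′ , refl)) eq = cong β (vertexSum-β-injective eq)

  decomposition⇒antimagic : ∀ {p q μ} → Decomposition p q μ → 1 ≤ p → p + p ≤ q → Antimagic G
  decomposition⇒antimagic {suc P} D _ 2p≤q with t , refl ← m≤n⇒∃[o]m+o≡n 2p≤q = φ D , φ-antimagic D

  -- The decomposition of a complete multipartite graph at a smallest class.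

  module _ {k : ℕ} (c : Vertex → Fin (suc (suc (suc k)))) (c-onto : ∀ a → ∃[ v ] c v ≡ a)
           (c-adj : ∀ u v → (u ~ v) ⇔ (c u ≢ c v)) where

    class : Fin (3 + k) → List Vertex
    class a = filter (λ v → c v ≟ a) (allFin n)

    class-unique : ∀ a → Unique (class a)
    class-unique a = Uniqueₚ.filter⁺ _ (Uniqueₚ.allFin⁺ n)

    ∈-class⁺ : ∀ {a v} → c v ≡ a → v ∈ class a
    ∈-class⁺ {a} {v} eq = ∈-filter⁺ (λ v → c v ≟ a) (∈-allFin v) eq

    ∈-class⁻ : ∀ {a v} → v ∈ class a → c v ≡ a
    ∈-class⁻ {a} v∈ = proj₂ (∈-filter⁻ (λ v → c v ≟ a) {xs = allFin n} v∈)

    a₀ : Fin (3 + k)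
    a₀ = proj₁ (minimiser (length ∘ class))

    As : List Vertex
    As = class a₀

    p : ℕ
    p = length As

    p≤class : ∀ a → p ≤ length (class a)
    p≤class = proj₂ (minimiser (length ∘ class))

    InnerEdge : Edge → Set
    InnerEdge e = c (src e) ≢ a₀ × c (tgt e) ≢ a₀

    innerEdges : List Edge
    innerEdges = filter (λ e → ¬? (c (src e) ≟ a₀) ×-dec ¬? (c (tgt e) ≟ a₀)) edges

    innerEdges-unique : Unique innerEdges
    innerEdges-unique = Uniqueₚ.filter⁺ _ edges-unique

    ∈-innerEdges⁻ : ∀ {e} → e ∈ innerEdges → InnerEdge e
    ∈-innerEdges⁻ e∈ = proj₂ (∈-filter⁻ (λ e → ¬? (c (src e) ≟ a₀) ×-dec ¬? (c (tgt e) ≟ a₀)) {xs = edges} e∈)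

    -- This agrees with `inner` of the decomposition built below. It is stated in advance because
    -- `Bs` has to be sorted by these sums before there is a `β`.
    innerAt : Vertex → List (Fin (length innerEdges))
    innerAt v = filter (λ x → incident? v (lookup innerEdges x)) (allFin (length innerEdges))

    innerSumAt : Vertex → ℕ
    innerSumAt v = sum (map (suc ∘ toℕ) (innerAt v))

    others : List Vertex
    others = filter (λ v → ¬? (c v ≟ a₀)) (allFin n)

    Bs : List Vertex
    Bs = proj₁ (sortOn innerSumAt others)

    Bs↭others : Bs ↭ others
    Bs↭others = proj₁ (proj₂ (sortOn innerSumAt others))

    q : ℕ
    q = length Bs

    Bs-unique : Unique Bs
    Bs-unique = Unique-resp-↭ (setoid Vertex) (↭⇒↭ₛ (↭-sym Bs↭others)) (Uniqueₚ.filter⁺ _ (Uniqueₚ.allFin⁺ n))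

    ∈-Bs⁺ : ∀ {v} → c v ≢ a₀ → v ∈ Bs
    ∈-Bs⁺ {v} ne = ∈-resp-↭ (↭-sym Bs↭others) (∈-filter⁺ (λ v → ¬? (c v ≟ a₀)) (∈-allFin v) ne)

    ∈-Bs⁻ : ∀ {v} → v ∈ Bs → c v ≢ a₀
    ∈-Bs⁻ v∈ = proj₂ (∈-filter⁻ (λ v → ¬? (c v ≟ a₀)) {xs = allFin n} (∈-resp-↭ Bs↭others v∈))

    -- The list `xs` followed by `class a` is duplicate-free and lies in B, and `class a` has at
    -- least `p` members. It serves both for `2p≤q`, with `xs` another class, and for `innerAt-≤`,
    -- with `xs` the neighbours of a vertex in B.
    class-disjoint⇒length≤q : ∀ a xs → a ≢ a₀ → Unique xs → (∀ {v} → v ∈ xs → c v ≢ a₀ × c v ≢ a) → length xs + p ≤ q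
    class-disjoint⇒length≤q a xs a≢a₀ uniq xs-outside = begin
      length xs + p                  ≤⟨ +-monoʳ-≤ (length xs) (p≤class a) ⟩
      length xs + length (class a)   ≡⟨ length-++ xs ⟨
      length (xs ++ class a)         ≤⟨ unique⊆⇒length≤ (Uniqueₚ.++⁺ uniq (class-unique a) (λ (v∈xs , v∈a) → proj₂ (xs-outside v∈xs) (∈-class⁻ v∈a))) ⊆Bs ⟩
      q                              ∎
      where
      open ≤-Reasoning
      ⊆Bs : ∀ {v} → v ∈ xs ++ class a → v ∈ Bs
      ⊆Bs v∈ = ∈-Bs⁺ (Sum.[ proj₁ ∘ xs-outside , (λ v∈a eq → a≢a₀ (trans (sym (∈-class⁻ v∈a)) eq)) ] (∈-++⁻ xs v∈))

    1≤p : 1 ≤ p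
    1≤p with v , eq ← c-onto a₀ = nonempty (∈-class⁺ eq)
      where
      nonempty : ∀ {v} {xs : List Vertex} → v ∈ xs → 1 ≤ length xs
      nonempty (here _)  = s≤s z≤n
      nonempty (there _) = s≤s z≤n

    2p≤q : p + p ≤ q
    2p≤q = ≤-trans (+-monoˡ-≤ p (p≤class a₁))
      (class-disjoint⇒length≤q a₂ (class a₁) (punchInᵢ≢i a₀ (suc zero)) (class-unique a₁)
        (λ v∈ → (λ eq → punchInᵢ≢i a₀ zero (trans (sym (∈-class⁻ v∈)) eq)) ,
                (λ eq → a₁≢a₂ (trans (sym (∈-class⁻ v∈)) eq))))
      where
      -- `punchIn a₀` runs through the indices other than `a₀`; three classes guarantee two of them.
      a₁ a₂ : Fin (3 + k)
      a₁ = punchIn a₀ zero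
      a₂ = punchIn a₀ (suc zero)
      a₁≢a₂ : a₁ ≢ a₂
      a₁≢a₂ eq with () ← punchIn-injective a₀ zero (suc zero) eq

    adjacent⇒≢ : ∀ e → c (src e) ≢ c (tgt e)
    adjacent⇒≢ e = Equivalence.to (c-adj (src e) (tgt e)) (src~tgt e)

    -- There are no more inner edges at `b` than neighbours of `b` in B, and these neighbours miss
    -- the class of `b`, which also lies in B.
    innerAt-≤ : ∀ b → c b ≢ a₀ → length (innerAt b) + p ≤ q
    innerAt-≤ b b∉A = ≤-trans (+-monoˡ-≤ p innerAt≤)
      (class-disjoint⇒length≤q (c b) neighbours b∉A (Uniqueₚ.filter⁺ _ (Uniqueₚ.allFin⁺ n))
        (λ v∈ → proj₂ (∈-filter⁻ neighbour? {xs = allFin n} v∈)))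
      where
      neighbour? = λ v → ¬? (c v ≟ a₀) ×-dec ¬? (c v ≟ c b)

      neighbours : List Vertex
      neighbours = filter neighbour? (allFin n)

      -- The count maps vertices to edges: each inner edge at `b` is the image of its other end, so
      -- the images of the neighbours include all of them. `Maybe` makes the map total on vertices
      -- not adjacent to `b`.
      edgeTo : Vertex → Maybe Edge
      edgeTo v with b ~? v
      ... | yes b~v = just (link b v b~v)
      ... | no _    = nothing

      edgeTo-incident : ∀ e {v} → c b ≢ c v → Incident b e → Incident v e → edgeTo v ≡ just e
      edgeTo-incident e {v} b≢v b∈e v∈e with b ~? v
      ... | yes b~v = cong just (incident-unique _ e (~⇒≢ b~v) (proj₁ (incident-link b~v)) (proj₂ (incident-link b~v)) b∈e v∈e)
      ... | no b≁v  = contradiction (Equivalence.from (c-adj b v) b≢v) b≁v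

      just-edge∈ : ∀ e {v} → c v ≢ a₀ → c b ≢ c v → Incident b e → Incident v e → just e ∈ map edgeTo neighbours
      just-edge∈ e {v} v∉A b≢v b∈e v∈e = subst (_∈ map edgeTo neighbours) (edgeTo-incident e b≢v b∈e v∈e)
        (∈-map⁺ edgeTo (∈-filter⁺ neighbour? (∈-allFin v) (v∉A , b≢v ∘ sym)))

      ⊆-edgeTo : ∀ {e} → e ∈ map (just ∘ lookup innerEdges) (innerAt b) → e ∈ map edgeTo neighbours
      ⊆-edgeTo e∈ with x , x∈ , refl ← ∈-map⁻ _ e∈
                  with proj₂ (∈-filter⁻ (λ x → incident? b (lookup innerEdges x)) {xs = allFin _} x∈)
                     | ∈-innerEdges⁻ (∈-lookup {xs = innerEdges} x)
      ... | inj₁ b≡s | _ , t∉A = just-edge∈ (lookup innerEdges x) t∉A (λ eq → adjacent⇒≢ (lookup innerEdges x) (trans (cong c (sym b≡s)) eq)) (inj₁ b≡s) (inj₂ refl)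
      ... | inj₂ b≡t | s∉A , _ = just-edge∈ (lookup innerEdges x) s∉A (λ eq → adjacent⇒≢ (lookup innerEdges x) (trans (sym eq) (cong c b≡t))) (inj₂ b≡t) (inj₁ refl)

      innerAt≤ : length (innerAt b) ≤ length neighbours
      innerAt≤ = begin
        length (innerAt b)                                   ≡⟨ length-map _ (innerAt b) ⟨
        length (map (just ∘ lookup innerEdges) (innerAt b))  ≤⟨ unique⊆⇒length≤ (Uniqueₚ.map⁺ (lookup-injective innerEdges-unique ∘ just-injective) (Uniqueₚ.filter⁺ _ (Uniqueₚ.allFin⁺ _))) ⊆-edgeTo ⟩
        length (map edgeTo neighbours)                       ≡⟨ length-map edgeTo neighbours ⟩
        length neighbours                                    ∎
        where open ≤-Reasoning

    smallestClassDecomposition : Decomposition p q (length innerEdges)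
    smallestClassDecomposition = record
      { α          = lookup As
      ; β          = lookup Bs
      ; γ          = lookup innerEdges
      ; α-inj      = lookup-injective (class-unique a₀)
      ; β-inj      = lookup-injective Bs-unique
      ; γ-inj      = lookup-injective innerEdges-unique
      ; cover      = cover′
      ; α≁α        = λ i i′ α~α → Equivalence.to (c-adj _ _) α~α (trans (α-class i) (sym (α-class i′)))
      ; β~α        = λ j i → Equivalence.from (c-adj _ _) (λ eq → ∈-Bs⁻ (∈-lookup j) (trans eq (α-class i)))
      ; γ-avoids-α = avoids
      -- An endpoint of class `a₀` would occur in `As`, so an edge that avoids `As` passes the
      -- filter defining `innerEdges`.
      ; γ-complete = λ e avoid → let e∈ = ∈-filter⁺ _ (∈-edges e) ((λ eq → notα {e} avoid inj₁ eq) , (λ eq → notα {e} avoid inj₂ eq))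
                                 in index e∈ , sym (lookup-index e∈)
      ; β-sorted   = proj₂ (proj₂ (sortOn innerSumAt others))
      ; β-inner-≤  = λ j → innerAt-≤ _ (∈-Bs⁻ (∈-lookup j))
      }
      where
      α-class : ∀ i → c (lookup As i) ≡ a₀
      α-class i = ∈-class⁻ (∈-lookup i)

      cover′ : ∀ v → (∃[ i ] v ≡ lookup As i) ⊎ (∃[ j ] v ≡ lookup Bs j)
      cover′ v with c v ≟ a₀
      ... | yes eq = inj₁ (_ , lookup-index (∈-class⁺ eq))
      ... | no ne  = inj₂ (_ , lookup-index (∈-Bs⁺ ne))

      avoids : ∀ x i → ¬ Incident (lookup As i) (lookup innerEdges x)
      avoids x i inc with ∈-innerEdges⁻ (∈-lookup {xs = innerEdges} x) | inc
      ... | s∉A , _ | inj₁ eq = s∉A (trans (cong c (sym eq)) (α-class i))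
      ... | _ , t∉A | inj₂ eq = t∉A (trans (cong c (sym eq)) (α-class i))

      notα : ∀ {e v} → (∀ i → ¬ Incident (lookup As i) e) → (∀ {u} → u ≡ v → Incident u e) → c v ≢ a₀
      notα avoid incident eq = avoid _ (incident (sym (lookup-index (∈-class⁺ eq))))

    multipartite⇒antimagic : Antimagic G
    multipartite⇒antimagic = decomposition⇒antimagic smallestClassDecomposition 1≤p 2p≤q

lemma5p2 : (k : ℕ) → 3 ≤ k → (G : Graph) → CompleteMultipartite k G → Antimagic G
lemma5p2 (suc (suc (suc k))) (s≤s (s≤s (s≤s z≤n))) G (c , c-onto , c-adj) =
  multipartite⇒antimagic G c (λ a → let v , hits = c-onto a in v , hits refl) c-adj
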